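{- Let $n,i,j$ be positive integers with $i+2\le j\le n-1$, and let $\lambda=i\,n\,(j-1)\,j$ and $\mu=(j-1)\,j\,n\,i$ (words of length $4$). For $\pi\in X_n(\lambda)$ with $\lambda$-decomposition $(\alpha,\lambda,\gamma,\delta)$, the permutation $\gamma'\mu\alpha'\delta$ lies in $X_n(\mu)$ and its $\mu$-decomposition is $(\gamma',\mu,\alpha',\delta)$. The map $X_n(\lambda)\to X_n(\mu)$ given by $(\alpha,\lambda,\gamma,\delta)\mapsto(\gamma',\mu,\alpha',\delta)$ (i.e. $\pi\mapsto\gamma'\mu\alpha'\delta$) is a bijection, whose inverse is the map sending $\sigma\in X_n(\mu)$ with $\mu$-decomposition $(\alpha,\mu,\gamma,\delta)$ to $(\gamma',\lambda,\alpha',\delta)$, i.e. to $\gamma'\lambda\alpha'\delta$.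
   Context: For a word $w=w_1\cdots w_k$ of pairwise distinct positive integers, an ascent is an index $t$ with $w_t<w_{t+1}$, a descent one with $w_t>w_{t+1}$, and the height is $h(w)=(\#\text{ascents})-(\#\text{descents})$ ($h(w)=0$ if $k\le1$). The word is ballot if every prefix has nonnegative height. $\mathcal{B}$ denotes the set of all finite ballot words of pairwise distinct positive integers (including the empty word). A ballot permutation of $[n]$ is a permutation $\pi_1\cdots\pi_n$ in one-line notation that is a ballot word. For a word $w$, $w_{ -1}$ is its last letter and $w'=w_k\cdots w_1$ its reversal. Juxtaposition denotes concatenation. For a nonempty $\omega\in\mathcal{B}$, $X_n(\omega)$ is the set of ballot permutations $\pi$ of $[n]$ that can be written as $\pi=\alpha\omega\gamma\delta$ (with $\alpha,\gamma,\delta$ possibly empty) such that $h(\alpha\omega\gamma)=h(\omega)$. For $\pi\in X_n(\omega)$, its $\omega$-decomposition is the (unique) 4-tuple $(\alpha,\omega,\gamma,\delta)$ with $\pi=\alpha\omega\gamma\delta$, $h(\alpha\omega\gamma)=h(\omega)$ and $\gamma'\omega_{ -1}\in\mathcal{B}$, where $\gamma$ is of maximal length among all words with these properties. -}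

module Defs where

open import Data.Bool using (if_then_else_)
open import Data.Integer as ℤ using (ℤ; +_; -[1+_]; 0ℤ)
import Data.Integer.Properties as ℤₚ
open import Data.Integer.Tactic.RingSolver using (solve-∀)
open import Data.List using (List; []; _∷_; [_]; _++_; length; reverse; take; drop; applyUpTo; initLast; _∷ʳ′_)
open import Data.List.NonEmpty as List⁺ using (List⁺; _∷_; toList)
import Data.List.Properties as Listₚ
open import Data.List.Relation.Binary.Permutation.Propositional using (_↭_; ↭-sym; prep; swap)
import Data.List.Relation.Binary.Permutation.Propositional as Perm
open import Data.List.Relation.Binary.Permutation.Propositional.Properties using (↭-reverse; All-resp-↭)
open import Data.List.Relation.Unary.All as All using (All; []; _∷_)
import Data.List.Relation.Unary.All.Properties as Allₚ
open import Data.List.Relation.Unary.AllPairs using ([]; _∷_)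
open import Data.List.Relation.Unary.Unique.Propositional using (Unique)
open import Data.List.Relation.Unary.Unique.DecPropositional using (unique?)
import Data.List.Relation.Unary.Unique.Propositional.Properties as Uniqueₚ
open import Data.Nat as ℕ using (ℕ; zero; suc; _+_; _<_; _≤_; z≤n; s≤s; _<?_; _>?_)
import Data.Nat.Properties as ℕₚ
open import Data.Product using (Σ; Σ-syntax; ∃-syntax; _×_; _,_; proj₁; proj₂)
open import Data.Empty using (⊥-elim)
open import Level using (0ℓ)
open import Function using (_∘_; flip)
open import Relation.Binary using (Rel; Decidable; Setoid; tri<; tri≈; tri>)
import Relation.Binary.Construct.On as On
import Relation.Binary.PropositionalEquality as ≡
open import Relation.Binary.PropositionalEquality using (_≡_; refl; sym; trans; cong; cong₂; subst; ≢-sym; module ≡-Reasoning)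
open import Relation.Nullary using (Dec; yes; no; does; ¬_)
open import Relation.Nullary.Decidable using (map′; _×-dec_; dec-true; dec-false)

Word : Set
Word = List ℕ

adjacent : ∀ {R : Rel ℕ 0ℓ} → Decidable R → Word → ℕ
adjacent R? []          = 0
adjacent R? (x ∷ [])    = 0
adjacent R? (x ∷ y ∷ w) = (if does (R? x y) then 1 else 0) + adjacent R? (y ∷ w)

ascents descents : Word → ℕ
ascents  = adjacent _<?_
descents = adjacent _>?_

h : Word → ℤ
h w = + ascents w ℤ.- + descents w

Ballot : Word → Set
Ballot w = ∀ u v → u ++ v ≡ w → 0ℤ ℤ.≤ h u

ℬ : Word → Set
ℬ w = All (1 ≤_) w × Unique w × Ballot w

IsPermutation : ℕ → Word → Set
IsPermutation n π = π ↭ applyUpTo suc n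

IsBallotPermutation : ℕ → Word → Set
IsBallotPermutation n π = IsPermutation n π × Ballot π

-- Membership in Xₙ(ω).  The notion is only used for ω ∈ ℬ, but it makes sense
-- for every nonempty ω.
InX : ℕ → List⁺ ℕ → Word → Set
InX n ω π = IsBallotPermutation n π ×
  (∃[ α ] ∃[ γ ] ∃[ δ ]
    (π ≡ α ++ toList ω ++ γ ++ δ × h (α ++ toList ω ++ γ) ≡ h (toList ω)))

-- Xₙ(ω) as a set of words: the membership proof does not count for equality.
X : ℕ → List⁺ ℕ → Setoid 0ℓ 0ℓ
X n ω = On.setoid {B = Σ Word (InX n ω)} (≡.setoid Word) proj₁

record Admissible (ω : List⁺ ℕ) (π α γ δ : Word) : Set where
  constructor admissible
  field
    splits : π ≡ α ++ toList ω ++ γ ++ δ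
    height : h (α ++ toList ω ++ γ) ≡ h (toList ω)
    ballot : ℬ (reverse γ ++ [ List⁺.last ω ])

record IsDecomposition (ω : List⁺ ℕ) (π α γ δ : Word) : Set where
  constructor isDecomposition
  field
    isAdmissible : Admissible ω π α γ δ
    maximal      : ∀ α₁ γ₁ δ₁ → Admissible ω π α₁ γ₁ δ₁ → length γ₁ ≤ length γ

-- Every π ∈ Xₙ(ω) has exactly one ω-decomposition, so quantifying over the
-- decompositions of π is the same as naming "the" decomposition of π.

adjacent-++ : ∀ {R : Rel ℕ 0ℓ} (R? : Decidable R) u x v →
  adjacent R? (u ++ x ∷ v) ≡ adjacent R? (u ++ [ x ]) + adjacent R? (x ∷ v)
adjacent-++ R? []          x v = refl
adjacent-++ R? (y ∷ [])    x v =
  cong (_+ adjacent R? (x ∷ v)) (sym (ℕₚ.+-identityʳ _))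
adjacent-++ R? (y ∷ z ∷ u) x v =
  trans (cong (_+_ _) (adjacent-++ R? (z ∷ u) x v)) (sym (ℕₚ.+-assoc (if does (R? y z) then 1 else 0) _ _))

adjacent-reverse : ∀ {R : Rel ℕ 0ℓ} (R? : Decidable R) w →
  adjacent R? (reverse w) ≡ adjacent (flip R?) w
adjacent-reverse R? []          = refl
adjacent-reverse R? (x ∷ [])    = refl
adjacent-reverse R? (x ∷ y ∷ w) = begin
  adjacent R? (reverse (x ∷ y ∷ w))
    ≡⟨ cong (adjacent R?) (Listₚ.unfold-reverse x (y ∷ w)) ⟩
  adjacent R? (reverse (y ∷ w) ++ [ x ])
    ≡⟨ cong (λ z → adjacent R? (z ++ [ x ])) (Listₚ.unfold-reverse y w) ⟩
  adjacent R? ((reverse w ++ [ y ]) ++ [ x ])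
    ≡⟨ cong (adjacent R?) (Listₚ.++-assoc (reverse w) [ y ] [ x ]) ⟩
  adjacent R? (reverse w ++ y ∷ [ x ])
    ≡⟨ adjacent-++ R? (reverse w) y [ x ] ⟩
  adjacent R? (reverse w ++ [ y ]) + (b + 0)
    ≡⟨ cong₂ _+_ (trans (cong (adjacent R?) (sym (Listₚ.unfold-reverse y w)))
                        (adjacent-reverse R? (y ∷ w)))
                 (ℕₚ.+-identityʳ b) ⟩
  adjacent (flip R?) (y ∷ w) + b
    ≡⟨ ℕₚ.+-comm _ b ⟩
  b + adjacent (flip R?) (y ∷ w) ∎
  where
  open ≡-Reasoning
  b = if does (R? y x) then 1 else 0

h-++ : ∀ u x v → h (u ++ x ∷ v) ≡ h (u ++ [ x ]) ℤ.+ h (x ∷ v)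
h-++ u x v
  rewrite adjacent-++ _<?_ u x v | adjacent-++ _>?_ u x v
        | ℤₚ.pos-+ (ascents (u ++ [ x ])) (ascents (x ∷ v))
        | ℤₚ.pos-+ (descents (u ++ [ x ])) (descents (x ∷ v))
  = shuffle (+ ascents (u ++ [ x ])) (+ ascents (x ∷ v)) (+ descents (u ++ [ x ])) (+ descents (x ∷ v))
  where
  shuffle : ∀ a b c d → (a ℤ.+ b) ℤ.- (c ℤ.+ d) ≡ (a ℤ.- c) ℤ.+ (b ℤ.- d)
  shuffle = solve-∀

h-reverse : ∀ w → h (reverse w) ≡ ℤ.- h w
h-reverse w
  rewrite adjacent-reverse _<?_ w | adjacent-reverse _>?_ w
  = negate (+ ascents w) (+ descents w)
  where
  negate : ∀ a b → b ℤ.- a ≡ ℤ.- (a ℤ.- b)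
  negate = solve-∀

ascent : ∀ {x y} → x < y → h (x ∷ y ∷ []) ≡ + 1
ascent {x} {y} x<y
  rewrite dec-true (x <? y) x<y | dec-false (y <? x) (ℕₚ.<-asym x<y) = refl

descent : ∀ {x y} → y < x → h (x ∷ y ∷ []) ≡ -[1+ 0 ]
descent {x} {y} y<x
  rewrite dec-true (y <? x) y<x | dec-false (x <? y) (ℕₚ.<-asym y<x) = refl

unique-suffix : ∀ (u : Word) {v} → Unique (u ++ v) → Unique v
unique-suffix []      p       = p
unique-suffix (x ∷ u) (_ ∷ p) = unique-suffix u p

unique-prefix : ∀ (u : Word) {v} → Unique (u ++ v) → Unique u
unique-prefix []      p       = []
unique-prefix (x ∷ u) (q ∷ p) = Allₚ.++⁻ˡ u q ∷ unique-prefix u p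

last-split : ∀ (ω : List⁺ ℕ) → ∃[ ω₀ ] toList ω ≡ ω₀ ++ [ List⁺.last ω ]
last-split (x ∷ xs) with initLast xs
... | []       = [] , refl
... | ys ∷ʳ′ y = x ∷ ys , refl

-- Cut after the first point where the height of x γ reaches -a: there every
-- suffix has nonpositive height.
NonposSuffixes : Word → Set
NonposSuffixes w = ∀ u v → u ++ v ≡ w → h v ℤ.≤ 0ℤ

extend : ∀ {x w} → h (x ∷ w) ℤ.≤ 0ℤ → NonposSuffixes w → NonposSuffixes (x ∷ w)
extend p q []      v refl = p
extend p q (_ ∷ u) v refl = q u v refl

first-drop : ∀ (a : ℕ) x γ → Unique (x ∷ γ) → h (x ∷ γ) ≡ ℤ.- + a →
  ∃[ γ₁ ] ∃[ γ₂ ] (γ ≡ γ₁ ++ γ₂ × h (x ∷ γ₁) ≡ ℤ.- + a × NonposSuffixes (x ∷ γ₁))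
first-drop zero x γ _ _ = [] , γ , refl , refl ,
  extend ℤₚ.≤-refl λ { [] [] refl → ℤₚ.≤-refl }
first-drop (suc a) x (y ∷ γ) ((x≢y ∷ _) ∷ uniq) eq with ℕₚ.<-cmp x y
... | tri≈ _ x≡y _ = ⊥-elim (x≢y x≡y)
... | tri< x<y _ _ =
  let e = begin
        h (y ∷ γ)                                   ≡⟨ cancel (h (x ∷ [ y ])) (h (y ∷ γ)) ⟩
        h (x ∷ [ y ]) ℤ.+ h (y ∷ γ) ℤ.- h (x ∷ [ y ])  ≡⟨ cong₂ ℤ._-_ (trans (sym (h-++ [ x ] y γ)) eq) (ascent x<y) ⟩
        -[1+ a ] ℤ.- + 1                            ≡⟨ cong (-[1+_] ∘ suc) (ℕₚ.+-identityʳ a) ⟩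
        -[1+ suc a ]                                ∎
      γ₁ , γ₂ , γ≡ , hγ₁ , np = first-drop (suc (suc a)) y γ uniq e
      hx = trans (h-++ [ x ] y γ₁) (cong₂ ℤ._+_ (ascent x<y) hγ₁)
  in y ∷ γ₁ , γ₂ , cong (y ∷_) γ≡ , hx ,
     extend (ℤₚ.≤-trans (ℤₚ.≤-reflexive hx) ℤ.-≤+) np
  where
  open ≡-Reasoning
  cancel : ∀ p q → q ≡ p ℤ.+ q ℤ.- p
  cancel = solve-∀
... | tri> _ _ y<x =
  let e = begin
        h (y ∷ γ)                                   ≡⟨ cancel (h (x ∷ [ y ])) (h (y ∷ γ)) ⟩
        h (x ∷ [ y ]) ℤ.+ h (y ∷ γ) ℤ.- h (x ∷ [ y ])  ≡⟨ cong₂ ℤ._-_ (trans (sym (h-++ [ x ] y γ)) eq) (descent y<x) ⟩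
        -[1+ a ] ℤ.- -[1+ 0 ]                       ≡⟨ lower a ⟩
        ℤ.- + a                                     ∎
      γ₁ , γ₂ , γ≡ , hγ₁ , np = first-drop a y γ uniq e
      hx = trans (h-++ [ x ] y γ₁) (trans (cong₂ ℤ._+_ (descent y<x) hγ₁) (raise a))
  in y ∷ γ₁ , γ₂ , cong (y ∷_) γ≡ , hx ,
     extend (ℤₚ.≤-trans (ℤₚ.≤-reflexive hx) ℤ.-≤+) np
  where
  open ≡-Reasoning
  cancel : ∀ p q → q ≡ p ℤ.+ q ℤ.- p
  cancel = solve-∀
  lower : ∀ a → -[1+ a ] ℤ.- -[1+ 0 ] ≡ ℤ.- + a
  lower zero    = refl
  lower (suc a) = refl
  raise : ∀ a → -[1+ 0 ] ℤ.+ (ℤ.- + a) ≡ -[1+ a ]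
  raise zero    = refl
  raise (suc a) = refl

nonpos⇒ballot : ∀ x γ → NonposSuffixes (x ∷ γ) → Ballot (reverse γ ++ [ x ])
nonpos⇒ballot x γ np u v eq =
  subst (0ℤ ℤ.≤_) (trans (sym (h-reverse (reverse u))) (cong h (Listₚ.reverse-involutive u)))
    (ℤₚ.neg-mono-≤ (np (reverse v) (reverse u) (begin
      reverse v ++ reverse u     ≡⟨ Listₚ.reverse-++ u v ⟨
      reverse (u ++ v)           ≡⟨ cong reverse eq ⟩
      reverse (reverse γ ++ [ x ]) ≡⟨ cong reverse (Listₚ.unfold-reverse x γ) ⟨
      reverse (reverse (x ∷ γ))  ≡⟨ Listₚ.reverse-involutive (x ∷ γ) ⟩
      x ∷ γ                      ∎)))
  where open ≡-Reasoning

take-length : ∀ (u v : Word) → take (length u) (u ++ v) ≡ u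
take-length []      v = refl
take-length (x ∷ u) v = cong (x ∷_) (take-length u v)

drop-length : ∀ (u v : Word) → drop (length u) (u ++ v) ≡ v
drop-length []      v = refl
drop-length (x ∷ u) v = drop-length u v

length-≤ : ∀ (u v : Word) → length u ≤ length (u ++ v)
length-≤ []      v = z≤n
length-≤ (x ∷ u) v = s≤s (length-≤ u v)

ballot? : ∀ w → Dec (Ballot w)
ballot? w = map′
  (λ { p u v refl → subst (λ z → 0ℤ ℤ.≤ h z) (take-length u v) (p (s≤s (length-≤ u v))) })
  (λ p {k} _ → p (take k w) (drop k w) (Listₚ.take++drop≡id k w))
  (ℕₚ.allUpTo? (λ k → 0ℤ ℤ.≤? h (take k w)) (suc (length w)))

ℬ? : ∀ w → Dec (ℬ w)
ℬ? w = All.all? (1 ℕ.≤?_) w ×-dec unique? ℕₚ._≟_ w ×-dec ballot? w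

greatest : ∀ {P : ℕ → Set} → (∀ k → Dec (P k)) → ∀ b {k} → k ≤ b → P k →
  ∃[ m ] (m ≤ b × P m × (∀ k → k ≤ b → P k → k ≤ m))
greatest P? zero    z≤n p = 0 , z≤n , p , λ _ k≤0 _ → k≤0
greatest P? (suc b) k≤b p with P? (suc b)
... | yes q = suc b , ℕₚ.≤-refl , q , λ _ k≤b _ → k≤b
... | no ¬q =
  let below : ∀ {k} → k ≤ suc b → _ → k ≤ b
      below k≤ p = ℕₚ.≤-pred (ℕₚ.≤∧≢⇒< k≤ λ { refl → ¬q p })
      m , m≤b , pm , max = greatest P? b (below k≤b p) p
  in m , ℕₚ.m≤n⇒m≤1+n m≤b , pm , λ k k≤ pk → max k (below k≤ pk) pk

unique-resp-↭ : ∀ {u v : Word} → u ↭ v → Unique u → Unique v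
unique-resp-↭ Perm.refl        p = p
unique-resp-↭ (prep x q)       (x∉ ∷ p) = All-resp-↭ q x∉ ∷ unique-resp-↭ q p
unique-resp-↭ (swap x y q)     ((x≢y ∷ x∉) ∷ y∉ ∷ p) =
  (≢-sym x≢y ∷ All-resp-↭ q y∉) ∷ All-resp-↭ q x∉ ∷ unique-resp-↭ q p
unique-resp-↭ (Perm.trans q r) p = unique-resp-↭ r (unique-resp-↭ q p)

applyUpTo-unique : ∀ n → Unique (applyUpTo suc n)
applyUpTo-unique n = Uniqueₚ.applyUpTo⁺₁ suc n λ i<j _ eq → ℕₚ.<⇒≢ i<j (ℕₚ.suc-injective eq)

permutation-unique : ∀ {n π} → IsPermutation n π → Unique π
permutation-unique {n} p = unique-resp-↭ (↭-sym p) (applyUpTo-unique n)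

permutation-positive : ∀ {n π} → IsPermutation n π → All (1 ≤_) π
permutation-positive {n} p = All-resp-↭ (↭-sym p) (Allₚ.applyUpTo⁺₁ suc n λ _ → s≤s z≤n)

-- In a word with distinct letters a letter occurs at only one position.
same-prefix : ∀ (α₁ α₂ : Word) {x v₁ v₂} → Unique (α₁ ++ x ∷ v₁) →
  α₁ ++ x ∷ v₁ ≡ α₂ ++ x ∷ v₂ → α₁ ≡ α₂
same-prefix []       []       _ _    = refl
same-prefix []       (y ∷ α₂) (x∉ ∷ _) refl = ⊥-elim (All.head (Allₚ.++⁻ʳ α₂ x∉) refl)
same-prefix (y ∷ α₁) []       (y∉ ∷ _) refl = ⊥-elim (All.head (Allₚ.++⁻ʳ α₁ y∉) refl)
same-prefix (y ∷ α₁) (z ∷ α₂) (_ ∷ u) eq =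
  cong₂ _∷_ (Listₚ.∷-injectiveˡ eq) (same-prefix α₁ α₂ u (Listₚ.∷-injectiveʳ eq))

same-rest : ∀ {ω : List⁺ ℕ} α₁ α₂ {ρ₁ ρ₂} → Unique (α₁ ++ toList ω ++ ρ₁) →
  α₁ ++ toList ω ++ ρ₁ ≡ α₂ ++ toList ω ++ ρ₂ → α₁ ≡ α₂ × ρ₁ ≡ ρ₂
same-rest {ω} α₁ α₂ u eq with same-prefix α₁ α₂ u eq
... | refl = refl , Listₚ.++-cancelˡ (toList ω) _ _ (Listₚ.++-cancelˡ α₁ _ _ eq)

prefix-by-length : ∀ (u₁ u₂ : Word) {v₁ v₂} → length u₁ ≡ length u₂ →
  u₁ ++ v₁ ≡ u₂ ++ v₂ → u₁ ≡ u₂ × v₁ ≡ v₂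
prefix-by-length u₁ u₂ {v₁} {v₂} len eq with
    trans (sym (take-length u₁ v₁)) (trans (cong₂ take len eq) (take-length u₂ v₂))
... | refl = refl , Listₚ.++-cancelˡ u₁ _ _ eq

h-triple : ∀ α {x v} ω₀ {y} γ → x ∷ v ≡ ω₀ ++ [ y ] →
  h (α ++ x ∷ v ++ γ) ≡ h (α ++ [ x ]) ℤ.+ (h (x ∷ v) ℤ.+ h (y ∷ γ))
h-triple α {x} {v} ω₀ {y} γ eq = begin
  h (α ++ x ∷ v ++ γ)                    ≡⟨ h-++ α x (v ++ γ) ⟩
  h (α ++ [ x ]) ℤ.+ h (x ∷ v ++ γ)      ≡⟨ cong (λ z → h (α ++ [ x ]) ℤ.+ h (z ++ γ)) eq ⟩
  h (α ++ [ x ]) ℤ.+ h ((ω₀ ++ [ y ]) ++ γ) ≡⟨ cong (λ z → h (α ++ [ x ]) ℤ.+ h z) (Listₚ.++-assoc ω₀ [ y ] γ) ⟩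
  h (α ++ [ x ]) ℤ.+ h (ω₀ ++ y ∷ γ)     ≡⟨ cong (ℤ._+_ (h (α ++ [ x ]))) (h-++ ω₀ y γ) ⟩
  h (α ++ [ x ]) ℤ.+ (h (ω₀ ++ [ y ]) ℤ.+ h (y ∷ γ)) ≡⟨ cong (λ z → h (α ++ [ x ]) ℤ.+ (h z ℤ.+ h (y ∷ γ))) eq ⟨
  h (α ++ [ x ]) ℤ.+ (h (x ∷ v) ℤ.+ h (y ∷ γ)) ∎
  where open ≡-Reasoning

height-iff : ∀ a b c → (a ℤ.+ (b ℤ.+ c) ≡ b → c ≡ ℤ.- a) × (c ≡ ℤ.- a → a ℤ.+ (b ℤ.+ c) ≡ b)
height-iff a b c = (λ eq → trans (isolate a b c) (trans (cong (λ z → z ℤ.- b ℤ.- a) eq) (collapse a b)))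
              , λ { refl → cancel a b }
  where
  isolate : ∀ a b c → c ≡ a ℤ.+ (b ℤ.+ c) ℤ.- b ℤ.- a
  isolate = solve-∀
  collapse : ∀ a b → b ℤ.- b ℤ.- a ≡ ℤ.- a
  collapse = solve-∀
  cancel : ∀ a b → a ℤ.+ (b ℤ.+ ℤ.- a) ≡ b
  cancel = solve-∀

admissible-exists : ∀ {n} ω {π} → InX n ω π → ∃[ α ] ∃[ γ ] ∃[ δ ] Admissible ω π α γ δ
admissible-exists ω@(x ∷ v) ((perm , bal) , α , γ , δ , refl , ht) =
  let ω₀ , ω≡ = last-split ω
      y = List⁺.last ω
      hα≥0 = bal (α ++ [ x ]) (v ++ γ ++ δ) (Listₚ.++-assoc α [ x ] (v ++ γ ++ δ))
      a , a≡ = nonneg hα≥0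
      end = begin
        α ++ toList ω ++ γ ++ δ         ≡⟨ cong (λ z → α ++ z ++ γ ++ δ) ω≡ ⟩
        α ++ (ω₀ ++ [ y ]) ++ γ ++ δ    ≡⟨ cong (α ++_) (Listₚ.++-assoc ω₀ [ y ] (γ ++ δ)) ⟩
        α ++ ω₀ ++ y ∷ γ ++ δ           ∎
      uniq = unique-prefix (y ∷ γ) (unique-suffix ω₀ (unique-suffix α
               (subst Unique end (permutation-unique perm))))
      pos = Allₚ.++⁻ˡ (y ∷ γ) (Allₚ.++⁻ʳ ω₀ (Allₚ.++⁻ʳ α
               (subst (All (1 ≤_)) end (permutation-positive perm))))
      hγ = trans (proj₁ (height-iff _ _ _) (trans (sym (h-triple α ω₀ γ ω≡)) ht))
                 (cong ℤ.-_ a≡)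
      γ₁ , γ₂ , γ≡ , hγ₁ , np = first-drop a y γ uniq hγ
      yγ≡ = cong (y ∷_) γ≡
      perm₁ = subst (_↭ y ∷ γ₁) (Listₚ.unfold-reverse y γ₁) (↭-reverse (y ∷ γ₁))
  in α , γ₁ , γ₂ ++ δ , admissible
       (cong (λ z → α ++ toList ω ++ z) (trans (cong (_++ δ) γ≡) (Listₚ.++-assoc γ₁ γ₂ δ)))
       (trans (h-triple α ω₀ γ₁ ω≡)
              (proj₂ (height-iff _ _ _) (trans hγ₁ (cong ℤ.-_ (sym a≡)))))
       ( All-resp-↭ (↭-sym perm₁) (Allₚ.++⁻ˡ (y ∷ γ₁) (subst (All (1 ≤_)) yγ≡ pos))
       , unique-resp-↭ (↭-sym perm₁) (unique-prefix (y ∷ γ₁) (subst Unique yγ≡ uniq))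
       , nonpos⇒ballot y γ₁ np )
  where
  open ≡-Reasoning
  nonneg : ∀ {z} → 0ℤ ℤ.≤ z → ∃[ a ] z ≡ + a
  nonneg (ℤ.+≤+ {n = a} _) = a , refl

decomposition-exists : ∀ {n} ω {π} → InX n ω π → ∃[ α ] ∃[ γ ] ∃[ δ ] IsDecomposition ω π α γ δ
decomposition-exists ω inX@((perm , _) , _) with admissible-exists ω inX
... | α , γ , δ , admissible refl ht bl =
  let m , _ , (ht′ , bl′) , max = greatest P? (length ρ) (length-≤ γ δ)
        (subst (λ z → h (α ++ toList ω ++ z) ≡ h (toList ω) × ℬ (reverse z ++ [ List⁺.last ω ]))
               (sym (take-length γ δ)) (ht , bl))
  in α , take m ρ , drop m ρ , isDecomposition
       (admissible (cong (λ z → α ++ toList ω ++ z) (sym (Listₚ.take++drop≡id m ρ))) ht′ bl′)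
       (λ α₁ γ₁ δ₁ → bound m max α₁ γ₁ δ₁)
  where
  ρ = γ ++ δ
  P : ℕ → Set
  P k = h (α ++ toList ω ++ take k ρ) ≡ h (toList ω) × ℬ (reverse (take k ρ) ++ [ List⁺.last ω ])
  P? : ∀ k → Dec (P k)
  P? k = (_ ℤ.≟ _) ×-dec ℬ? _
  bound : ∀ m → (∀ k → k ≤ length ρ → P k → k ≤ m) → ∀ α₁ γ₁ δ₁ →
    Admissible ω (α ++ toList ω ++ ρ) α₁ γ₁ δ₁ → length γ₁ ≤ length (take m ρ)
  bound m max α₁ γ₁ δ₁ (admissible eq ht₁ bl₁)
    with same-rest {ω} α α₁ (permutation-unique perm) eq
  ... | refl , ρ≡ =
    let k≤ = subst (λ z → length γ₁ ≤ length z) (sym ρ≡) (length-≤ γ₁ δ₁)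
        take≡ = trans (cong (take (length γ₁)) ρ≡) (take-length γ₁ δ₁)
        k≤m = max (length γ₁) k≤
          (subst (λ z → h (α ++ toList ω ++ z) ≡ h (toList ω) × ℬ (reverse z ++ [ List⁺.last ω ]))
                 (sym take≡) (ht₁ , bl₁))
    in subst (length γ₁ ≤_) (sym (Listₚ.length-take m ρ)) (ℕₚ.⊓-glb k≤m k≤)

decomposition-unique : ∀ {n} ω {π} → InX n ω π → ∀ {α₁ γ₁ δ₁ α₂ γ₂ δ₂} →
  IsDecomposition ω π α₁ γ₁ δ₁ → IsDecomposition ω π α₂ γ₂ δ₂ →
  α₁ ≡ α₂ × γ₁ ≡ γ₂ × δ₁ ≡ δ₂
decomposition-unique ω ((perm , _) , _) {α₁} {γ₁} {δ₁} {α₂} {γ₂} {δ₂}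
  (isDecomposition A₁@(admissible eq₁ _ _) max₁) (isDecomposition A₂@(admissible eq₂ _ _) max₂)
  with same-rest {ω} α₁ α₂ (subst Unique eq₁ (permutation-unique perm)) (trans (sym eq₁) eq₂)
... | α≡ , ρ≡ = α≡ , prefix-by-length γ₁ γ₂ (ℕₚ.≤-antisym (max₂ _ _ _ A₁) (max₁ _ _ _ A₂)) ρ≡

{-# OPTIONS --safe #-}

-- For a ballot word ω of height 1 with first letter x and last letter y, the
-- ω-decompositions (α, ω, γ, δ) of ballot permutations are exactly the
-- factorisations in which αx, γ′y and δ are ballot and h(αx) = h(γ′y): given the
-- rest, maximality of γ amounts to δ being ballot.  Exchanging (α, γ) for
-- (γ′, α′) exchanges the roles of x and y.  For λ and μ the end letters are
-- (i, j) and (j−1, i), and j−1 and j compare alike with every other letter, so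
-- the conditions for λ at (α, γ, δ) are those for μ at (γ′, α′, δ).
module Submission where

open import Defs
open import Data.Empty using (⊥-elim)
open import Data.Integer as ℤ using (0ℤ; 1ℤ; -1ℤ; -[1+_])
import Data.Integer.Properties as ℤₚ
open import Data.Integer.Tactic.RingSolver using (solve-∀)
open import Data.List using ([]; _∷_; [_]; _++_; length; reverse)
open import Data.List.NonEmpty as List⁺ using (List⁺; _∷_; toList)
import Data.List.Properties as Listₚ
open import Data.List.Relation.Binary.Permutation.Propositional using (_↭_; ↭-refl; ↭-sym; ↭-trans; swap)
open import Data.List.Relation.Binary.Permutation.Propositional.Properties using (↭-reverse; All-resp-↭; ++⁺; shifts)
open import Data.List.Relation.Unary.All as All using (All; []; _∷_)
import Data.List.Relation.Unary.All.Properties as Allₚ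
open import Data.List.Relation.Unary.AllPairs using ([]; _∷_)
open import Data.List.Relation.Unary.Unique.Propositional using (Unique)
open import Data.List.Reverse using (Reverse; []; _∶_∶ʳ_; reverseView)
open import Data.Nat using (ℕ; suc; _+_; _∸_; _≤_; _<_; z≤n; s≤s)
import Data.Nat.Properties as ℕₚ
open import Data.Product using (_×_; Σ-syntax; ∃-syntax; _,_; proj₁; proj₂)
open import Data.Sum using (_⊎_; inj₁; inj₂)
open import Function.Bundles using (Inverse)
open import Relation.Binary using (tri<; tri≈; tri>)
open import Relation.Binary.Bundles using (Setoid)
open import Relation.Binary.PropositionalEquality using (_≡_; _≢_; refl; sym; trans; cong; cong₂; subst; ≢-sym; module ≡-Reasoning)
open import Relation.Nullary using (yes; no; ¬_)

-- Cuts of a word and heights of concatenations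

++-compare : ∀ (a : Word) {b} u {v} → u ++ v ≡ a ++ b →
  (∃[ c ] (a ≡ u ++ c × v ≡ c ++ b)) ⊎ (∃[ c ] (u ≡ a ++ c × b ≡ c ++ v))
++-compare a       []      eq = inj₁ (a , refl , eq)
++-compare []      (x ∷ u) eq = inj₂ (x ∷ u , refl , sym eq)
++-compare (y ∷ a) (x ∷ u) eq with Listₚ.∷-injective eq
... | refl , eq′ with ++-compare a u eq′
...   | inj₁ (c , p , q) = inj₁ (c , cong (x ∷_) p , q)
...   | inj₂ (c , p , q) = inj₂ (c , cong (x ∷_) p , q)

step : ∀ {x y} → x ≢ y → h (x ∷ y ∷ []) ≡ 1ℤ ⊎ h (x ∷ y ∷ []) ≡ -1ℤ
step {x} {y} x≢y with ℕₚ.<-cmp x y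
... | tri< x<y _ _ = inj₁ (ascent x<y)
... | tri≈ _ x≡y _ = ⊥-elim (x≢y x≡y)
... | tri> _ _ y<x = inj₂ (descent y<x)

-- The only adjacent pair lying in neither factor is the last letter of `u` followed by the first of
-- `v`; these letters differ, so the pair contributes 1 or -1. Unlike in `h-++`, the two factors
-- share no letter.
h-join : ∀ {u v} → u ≢ [] → v ≢ [] → Unique (u ++ v) →
  h (u ++ v) ≡ h u ℤ.+ h v ℤ.+ 1ℤ ⊎ h (u ++ v) ≡ h u ℤ.+ h v ℤ.+ -1ℤ
h-join {[]} u≢[] _ _ = ⊥-elim (u≢[] refl)
h-join {_ ∷ _} {[]} _ v≢[] _ = ⊥-elim (v≢[] refl)
h-join {a ∷ u} {b ∷ v} _ _ uniq = h-join′ (last-split (a ∷ u))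
  where
  swap-last : ∀ p q r → p ℤ.+ (r ℤ.+ q) ≡ p ℤ.+ q ℤ.+ r
  swap-last = solve-∀
  h-join′ : ∃[ w ] (a ∷ u ≡ w ++ [ List⁺.last (a ∷ u) ]) →
    h (a ∷ u ++ b ∷ v) ≡ h (a ∷ u) ℤ.+ h (b ∷ v) ℤ.+ 1ℤ ⊎
    h (a ∷ u ++ b ∷ v) ≡ h (a ∷ u) ℤ.+ h (b ∷ v) ℤ.+ -1ℤ
  h-join′ (w , eq) = result (step z≢b)
    where
    open ≡-Reasoning
    z = List⁺.last (a ∷ u)
    au++bv : a ∷ u ++ b ∷ v ≡ w ++ z ∷ b ∷ v
    au++bv = trans (cong (_++ b ∷ v) eq) (Listₚ.++-assoc w [ z ] (b ∷ v))
    z≢b : z ≢ b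
    z≢b with unique-suffix w (subst Unique au++bv uniq)
    ... | (z≢b ∷ _) ∷ _ = z≢b
    total : ∀ {s} → h (z ∷ b ∷ []) ≡ s → h (a ∷ u ++ b ∷ v) ≡ h (a ∷ u) ℤ.+ h (b ∷ v) ℤ.+ s
    total {s} s≡ = begin
      h (a ∷ u ++ b ∷ v)                                       ≡⟨ cong h au++bv ⟩
      h (w ++ z ∷ b ∷ v)                                       ≡⟨ h-++ w z (b ∷ v) ⟩
      h (w ++ [ z ]) ℤ.+ h (z ∷ b ∷ v)                         ≡⟨ cong₂ ℤ._+_ (cong h (sym eq)) (h-++ [ z ] b v) ⟩
      h (a ∷ u) ℤ.+ (h (z ∷ b ∷ []) ℤ.+ h (b ∷ v))             ≡⟨ swap-last (h (a ∷ u)) (h (b ∷ v)) _ ⟩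
      h (a ∷ u) ℤ.+ h (b ∷ v) ℤ.+ h (z ∷ b ∷ [])               ≡⟨ cong (ℤ._+_ (h (a ∷ u) ℤ.+ h (b ∷ v))) s≡ ⟩
      h (a ∷ u) ℤ.+ h (b ∷ v) ℤ.+ s                            ∎
    result : h (z ∷ b ∷ []) ≡ 1ℤ ⊎ h (z ∷ b ∷ []) ≡ -1ℤ →
      h (a ∷ u ++ b ∷ v) ≡ h (a ∷ u) ℤ.+ h (b ∷ v) ℤ.+ 1ℤ ⊎
      h (a ∷ u ++ b ∷ v) ≡ h (a ∷ u) ℤ.+ h (b ∷ v) ℤ.+ -1ℤ
    result (inj₁ s≡) = inj₁ (total s≡)
    result (inj₂ s≡) = inj₂ (total s≡)

h≢0⇒≢[] : ∀ {w z} → h w ≡ z → z ≢ 0ℤ → w ≢ []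
h≢0⇒≢[] h≡ z≢0 refl = z≢0 (sym h≡)

-- Heights of consecutive prefixes differ by one, so a negative value is
-- reached only through -1.
prefix-at-−1 : ∀ {p} → Reverse p → Unique p → h p ℤ.< 0ℤ → ∃[ u ] ∃[ v ] (p ≡ u ++ v × h u ≡ -1ℤ)
prefix-at-−1 [] _ (ℤ.+<+ ())
prefix-at-−1 ([] ∶ _ ∶ʳ x) _ (ℤ.+<+ ())
prefix-at-−1 (w@(_ ∷ _) ∶ rs ∶ʳ x) uniq neg with h (w ++ [ x ]) ℤ.≟ -1ℤ
... | yes eq = w ++ [ x ] , [] , sym (Listₚ.++-identityʳ _) , eq
... | no ≢-1 =
  let u , v , w≡ , hu = prefix-at-−1 rs (unique-prefix w uniq)
        (back (h w) (h (w ++ [ x ])) (h-join {w} (λ ()) (λ ()) uniq) neg ≢-1)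
  in u , v ++ [ x ] , trans (cong (_++ [ x ]) w≡) (Listₚ.++-assoc u v [ x ]) , hu
  where
  -- The summand `0ℤ` is the height of the one-letter word `[ x ]`. A value below -1 cannot be
  -- reached in one step from a nonnegative one, so `w` is already negative and the search continues
  -- there.
  back : ∀ a b → b ≡ a ℤ.+ 0ℤ ℤ.+ 1ℤ ⊎ b ≡ a ℤ.+ 0ℤ ℤ.+ -1ℤ → b ℤ.< 0ℤ → b ≢ -1ℤ → a ℤ.< 0ℤ
  back (-[1+ _ ])    _ _           _          _   = ℤ.-<+
  back (ℤ.+ _)       _ (inj₁ refl) (ℤ.+<+ ()) _
  back (ℤ.+ 0)       _ (inj₂ refl) _          ≢-1 = ⊥-elim (≢-1 refl)
  back (ℤ.+ (suc _)) _ (inj₂ refl) (ℤ.+<+ ()) _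

-- Gluing ballot words and words with nonpositive suffixes

ballot-prefix : ∀ u {v} → Ballot (u ++ v) → Ballot u
ballot-prefix u {v} bal p q refl = bal p (q ++ v) (sym (Listₚ.++-assoc p q v))

-- A suffix that starts inside `u` is `c ++ v` with `c` a suffix of `u`. The height -1 of `v`
-- absorbs even an ascent at the joint, so the total is at most `h c`.
nonpos-++ : ∀ u {v} → Unique (u ++ v) → NonposSuffixes u → NonposSuffixes v → h v ≡ -1ℤ →
  NonposSuffixes (u ++ v)
nonpos-++ u {v} uniq npu npv hv p q eq with ++-compare u p eq
... | inj₂ (c , _ , v≡)          = npv c q (sym v≡)
... | inj₁ ([] , _ , refl)       = npv [] v refl
... | inj₁ (c@(_ ∷ _) , u≡ , refl) =
  bound (npu p c (sym u≡))
    (h-join {c} (λ ()) (h≢0⇒≢[] {v} hv λ ())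
      (unique-suffix p (subst Unique (sym eq) uniq)))
  where
  open ℤₚ.≤-Reasoning
  bound : h c ℤ.≤ 0ℤ → h (c ++ v) ≡ h c ℤ.+ h v ℤ.+ 1ℤ ⊎ h (c ++ v) ≡ h c ℤ.+ h v ℤ.+ -1ℤ →
    h (c ++ v) ℤ.≤ 0ℤ
  bound hc≤0 (inj₁ e) = begin
    h (c ++ v)              ≡⟨ trans e (cong (λ z → h c ℤ.+ z ℤ.+ 1ℤ) hv) ⟩
    h c ℤ.+ -1ℤ ℤ.+ 1ℤ      ≤⟨ ℤₚ.+-monoˡ-≤ 1ℤ (ℤₚ.+-monoˡ-≤ -1ℤ hc≤0) ⟩
    0ℤ                      ∎
  bound hc≤0 (inj₂ e) = begin
    h (c ++ v)              ≡⟨ trans e (cong (λ z → h c ℤ.+ z ℤ.+ -1ℤ) hv) ⟩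
    h c ℤ.+ -1ℤ ℤ.+ -1ℤ     ≤⟨ ℤₚ.+-monoˡ-≤ -1ℤ (ℤₚ.+-monoˡ-≤ -1ℤ hc≤0) ⟩
    -[1+ 1 ]                ≤⟨ ℤ.-≤+ ⟩
    0ℤ                      ∎

ballot⇒nonpos : ∀ y γ → Ballot (reverse γ ++ [ y ]) → NonposSuffixes (y ∷ γ)
ballot⇒nonpos y γ bal u v eq =
  subst (ℤ._≤ 0ℤ) (trans (cong ℤ.-_ (h-reverse v)) (ℤₚ.neg-involutive (h v)))
    (ℤₚ.neg-mono-≤ (bal (reverse v) (reverse u)
      (trans (sym (Listₚ.reverse-++ u v)) (trans (cong reverse eq) (Listₚ.unfold-reverse y γ)))))

-- The two pieces overlap in the letter `x`, so the height of a prefix reaching beyond `x` is an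
-- exact sum, with no joint to account for.
ballot-glue : ∀ a {x b} → Ballot (a ++ [ x ]) →
  (∀ p q → p ++ q ≡ b → 0ℤ ℤ.≤ h (a ++ [ x ]) ℤ.+ h (x ∷ p)) → Ballot (a ++ x ∷ b)
ballot-glue a {x} {b} bal above u v eq
  with ++-compare (a ++ [ x ]) u (trans eq (sym (Listₚ.++-assoc a [ x ] b)))
... | inj₁ (c , ax≡ , _)    = bal u c (sym ax≡)
... | inj₂ (c , refl , b≡)  = subst (0ℤ ℤ.≤_)
        (sym (trans (cong h (Listₚ.++-assoc a [ x ] c)) (h-++ a x c)))
        (above c v (sym b≡))

-- The height 1 of `u` pays for a possible descent at the joint.
ballot-++ : ∀ {u v} → Unique (u ++ v) → h u ≡ 1ℤ → Ballot u → Ballot v → Ballot (u ++ v)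
ballot-++ {u} {v} uniq hu balu balv p q eq with ++-compare u p eq
... | inj₁ (c , u≡ , _)       = balu p c (sym u≡)
... | inj₂ ([] , refl , _)    = balu (u ++ []) [] (trans (Listₚ.++-identityʳ _) (Listₚ.++-identityʳ u))
... | inj₂ (c@(_ ∷ _) , refl , v≡) =
  bound (balv c q (sym v≡)) (h-join {u} (h≢0⇒≢[] {u} hu λ ()) (λ ())
    (unique-prefix (u ++ c) (subst Unique (sym eq) uniq)))
  where
  open ℤₚ.≤-Reasoning
  bound : 0ℤ ℤ.≤ h c → h (u ++ c) ≡ h u ℤ.+ h c ℤ.+ 1ℤ ⊎ h (u ++ c) ≡ h u ℤ.+ h c ℤ.+ -1ℤ →
    0ℤ ℤ.≤ h (u ++ c)
  bound 0≤ (inj₁ e) = begin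
    0ℤ                      ≤⟨ ℤ.+≤+ z≤n ⟩
    1ℤ ℤ.+ 0ℤ ℤ.+ 1ℤ        ≤⟨ ℤₚ.+-monoˡ-≤ 1ℤ (ℤₚ.+-monoʳ-≤ 1ℤ 0≤) ⟩
    1ℤ ℤ.+ h c ℤ.+ 1ℤ       ≡⟨ trans e (cong (λ z → z ℤ.+ h c ℤ.+ 1ℤ) hu) ⟨
    h (u ++ c)              ∎
  bound 0≤ (inj₂ e) = begin
    1ℤ ℤ.+ 0ℤ ℤ.+ -1ℤ       ≤⟨ ℤₚ.+-monoˡ-≤ -1ℤ (ℤₚ.+-monoʳ-≤ 1ℤ 0≤) ⟩
    1ℤ ℤ.+ h c ℤ.+ -1ℤ      ≡⟨ trans e (cong (λ z → z ℤ.+ h c ℤ.+ -1ℤ) hu) ⟨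
    h (u ++ c)              ∎

-- Decompositions as balanced factorisations

-- With x and y the first and last letters of ω, these conditions describe the
-- ω-decompositions (α, ω, γ, δ).  They are symmetric under (x, y, α, γ) ↦
-- (y, x, γ′, α′).
record Balanced (x y : ℕ) (α γ δ : Word) : Set where
  constructor balanced
  field
    left  : Ballot (α ++ [ x ])
    right : Ballot (reverse γ ++ [ y ])
    level : h (α ++ [ x ]) ≡ h (reverse γ ++ [ y ])
    rest  : Ballot δ

balanced-reverse : ∀ {x y} α {β δ} → Ballot (β ++ [ x ]) → Ballot (α ++ [ y ]) →
  h (β ++ [ x ]) ≡ h (α ++ [ y ]) → Ballot δ → Balanced x y β (reverse α) δ
balanced-reverse {y = y} α left right level rest = balanced left
  (subst (λ w → Ballot (w ++ [ y ])) (sym (Listₚ.reverse-involutive α)) right)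
  (trans level (cong (λ w → h (w ++ [ y ])) (sym (Listₚ.reverse-involutive α)))) rest

h-reverse-∷ : ∀ y γ → h (reverse γ ++ [ y ]) ≡ ℤ.- h (y ∷ γ)
h-reverse-∷ y γ = trans (cong h (sym (Listₚ.unfold-reverse y γ))) (h-reverse (y ∷ γ))

-- With `y` the last letter of ω, `y ∷ γ` is a factor of a permutation, and positivity and
-- distinctness of its letters survive reversal. Only the ballot condition carries information.
ballot⇒ℬ : ∀ {n} α ω γ {δ} → IsPermutation n (α ++ toList ω ++ γ ++ δ) →
  Ballot (reverse γ ++ [ List⁺.last ω ]) → ℬ (reverse γ ++ [ List⁺.last ω ])
ballot⇒ℬ α ω γ {δ} perm bal with last-split ω
... | ω₀ , ω≡ = All-resp-↭ (↭-sym turn) pos , unique-resp-↭ (↭-sym turn) uniq , bal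
  where
  y = List⁺.last ω
  turn : reverse γ ++ [ y ] ↭ y ∷ γ
  turn = subst (_↭ y ∷ γ) (Listₚ.unfold-reverse y γ) (↭-reverse (y ∷ γ))
  π≡ : α ++ toList ω ++ γ ++ δ ≡ α ++ ω₀ ++ y ∷ γ ++ δ
  π≡ = cong (α ++_) (trans (cong (_++ γ ++ δ) ω≡) (Listₚ.++-assoc ω₀ [ y ] (γ ++ δ)))
  pos : All (1 ≤_) (y ∷ γ)
  pos = Allₚ.++⁻ˡ (y ∷ γ) (Allₚ.++⁻ʳ ω₀ (Allₚ.++⁻ʳ α
          (subst (All (1 ≤_)) π≡ (permutation-positive perm))))
  uniq : Unique (y ∷ γ)
  uniq = unique-prefix (y ∷ γ) (unique-suffix ω₀ (unique-suffix α
          (subst Unique π≡ (permutation-unique perm))))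

++-assoc₃ : ∀ (a b c d : Word) → a ++ b ++ c ++ d ≡ (a ++ b ++ c) ++ d
++-assoc₃ a b c d = trans (cong (a ++_) (sym (Listₚ.++-assoc b c d))) (sym (Listₚ.++-assoc a (b ++ c) d))

-- A prefix of δ of negative height would let γ be extended.
maximal⇒ballot : ∀ {n} ω {π α γ δ} → h (toList ω) ≡ 1ℤ → IsBallotPermutation n π →
  IsDecomposition ω π α γ δ → Ballot δ
maximal⇒ballot ω {π} {α} {γ} {δ} hω (perm , bal)
  (isDecomposition (admissible refl ht (_ , _ , balγ)) max) u v refl with 0ℤ ℤ.≤? h u
... | yes 0≤ = 0≤
... | no 0≰ = ⊥-elim (ℕₚ.<-irrefl refl (ℕₚ.<-≤-trans longer (max α (γ ++ P) R adm)))
  where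
  M = α ++ toList ω ++ γ
  y = List⁺.last ω
  uniq : Unique (M ++ u ++ v)
  uniq = subst Unique (++-assoc₃ α (toList ω) γ (u ++ v)) (permutation-unique perm)
  uniq-u : Unique u
  uniq-u = unique-prefix u (unique-suffix M uniq)
  -- `prefix-at-−1` finds some prefix of height -1; `first-drop` shortens it to one all of whose
  -- suffixes are nonpositive, which is what appending it to γ requires.
  cut : ∃[ P ] ∃[ R ] (u ≡ P ++ R × h P ≡ -1ℤ × NonposSuffixes P)
  cut with prefix-at-−1 (reverseView u) uniq-u (ℤₚ.≰⇒> 0≰)
  ... | d ∷ w , t , refl , hw with first-drop 1 d w (unique-prefix (d ∷ w) uniq-u) hw
  ...   | γ₁ , γ₂ , refl , hγ₁ , np = d ∷ γ₁ , γ₂ ++ t , cong (d ∷_) (Listₚ.++-assoc γ₁ γ₂ t) , hγ₁ , np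
  P = proj₁ cut
  R = proj₁ (proj₂ cut) ++ v
  hP : h P ≡ -1ℤ
  hP = proj₁ (proj₂ (proj₂ (proj₂ cut)))
  npP : NonposSuffixes P
  npP = proj₂ (proj₂ (proj₂ (proj₂ cut)))
  δ≡ : u ++ v ≡ P ++ R
  δ≡ = trans (cong (_++ v) (proj₁ (proj₂ (proj₂ cut)))) (Listₚ.++-assoc P _ v)
  P≢[] : P ≢ []
  P≢[] = h≢0⇒≢[] {P} hP λ ()
  longer : length γ < length (γ ++ P)
  longer with P | P≢[]
  ... | []    | P≢ = ⊥-elim (P≢ refl)
  ... | _ ∷ _ | _  = subst (length γ <_) (sym (Listₚ.length-++ γ)) (ℕₚ.m<m+n (length γ) (s≤s z≤n))
  π≡ : α ++ toList ω ++ γ ++ u ++ v ≡ α ++ toList ω ++ (γ ++ P) ++ R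
  π≡ = cong (λ z → α ++ toList ω ++ z) (trans (cong (γ ++_) δ≡) (sym (Listₚ.++-assoc γ P R)))
  M++P++R : (M ++ P) ++ R ≡ α ++ toList ω ++ γ ++ u ++ v
  M++P++R = trans (Listₚ.++-assoc M P R) (trans (cong (M ++_) (sym δ≡)) (sym (++-assoc₃ α (toList ω) γ (u ++ v))))
  hM : h M ≡ 1ℤ
  hM = trans ht hω
  uniq-MP : Unique (M ++ P)
  uniq-MP = unique-prefix (M ++ P) (subst Unique (sym M++P++R) (permutation-unique perm))
  -- The two candidates are 1 - 1 + 1 and 1 - 1 - 1; the negative one is excluded because `M ++ P`
  -- is a prefix of a ballot word.
  hMP : h (M ++ P) ≡ 1ℤ
  hMP with h (M ++ P) | h-join {M} {P} (h≢0⇒≢[] {M} hM λ ()) P≢[] uniq-MP | bal (M ++ P) R M++P++R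
  ... | _ | inj₁ refl | _ = cong₂ (λ a b → a ℤ.+ b ℤ.+ 1ℤ) hM hP
  ... | _ | inj₂ refl | 0≤ with subst (0ℤ ℤ.≤_) (cong₂ (λ a b → a ℤ.+ b ℤ.+ -1ℤ) hM hP) 0≤
  ...   | ()
  uniq-yγP : Unique (y ∷ γ ++ P)
  uniq-yγP with last-split ω
  ... | ω₀ , ω≡ = unique-prefix (y ∷ γ ++ P) {R} (unique-suffix ω₀ (unique-suffix α
          (subst Unique (trans π≡ (cong (α ++_) (trans (cong (_++ (γ ++ P) ++ R) ω≡) (Listₚ.++-assoc ω₀ [ y ] _))))
            (permutation-unique perm))))
  adm : Admissible ω (α ++ toList ω ++ γ ++ u ++ v) α (γ ++ P) R
  adm = admissible π≡
    (trans (cong h (++-assoc₃ α (toList ω) γ P)) (trans hMP (sym hω)))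
    (ballot⇒ℬ α ω (γ ++ P) (subst (IsPermutation _) π≡ perm)
      (nonpos⇒ballot y (γ ++ P) (nonpos-++ (y ∷ γ) uniq-yγP (ballot⇒nonpos y γ balγ) npP hP)))

-- Write x and y for the first and last letters of ω. Cutting αωγ at them with `h-triple` turns the
-- height condition into h(αx) + h(yγ) = 0. Reversal negates h(yγ), which gives `level`.
decomposition⇒balanced : ∀ {n} ω {π α γ δ} → h (toList ω) ≡ 1ℤ → IsBallotPermutation n π →
  IsDecomposition ω π α γ δ → Balanced (List⁺.head ω) (List⁺.last ω) α γ δ
decomposition⇒balanced ω@(x ∷ v) {α = α} {γ} {δ} hω bp@(_ , bal)
  D@(isDecomposition (admissible refl ht (_ , _ , balγ)) _) with last-split ω
... | ω₀ , ω≡ = balanced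
  (ballot-prefix (α ++ [ x ]) (subst Ballot (sym (Listₚ.++-assoc α [ x ] (v ++ γ ++ δ))) bal))
  balγ
  (sym (trans (h-reverse-∷ (List⁺.last ω) γ)
    (trans (cong ℤ.-_ (proj₁ (height-iff _ _ _) (trans (sym (h-triple α ω₀ γ ω≡)) ht)))
           (ℤₚ.neg-involutive _))))
  (maximal⇒ballot ω hω bp D)

h-suffix : ∀ p {z q} → Ballot (p ++ z ∷ q) → h (z ∷ q) ℤ.≤ h (p ++ z ∷ q)
h-suffix p {z} {q} bal = subst (h (z ∷ q) ℤ.≤_) (sym (h-++ p z q))
  (subst (ℤ._≤ h (p ++ [ z ]) ℤ.+ h (z ∷ q)) (ℤₚ.+-identityˡ _)
    (ℤₚ.+-monoˡ-≤ (h (z ∷ q)) (bal (p ++ [ z ]) q (Listₚ.++-assoc p [ z ] q))))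

-- The reversal of `y ∷ p` is a suffix of the ballot word `reverse γ ++ [ y ]`, so by `h-suffix` its
-- height is at most that of the whole word. Negating gives the bound.
h-prefix-≥ : ∀ y γ p q → p ++ q ≡ γ → Ballot (reverse γ ++ [ y ]) →
  ℤ.- h (reverse γ ++ [ y ]) ℤ.≤ h (y ∷ p)
h-prefix-≥ y γ p q refl bal =
  subst (ℤ.- h (reverse (p ++ q) ++ [ y ]) ℤ.≤_)
    (trans (cong ℤ.-_ (h-reverse-∷ y p)) (ℤₚ.neg-involutive _))
    (ℤₚ.neg-mono-≤ (subst (λ w → h (reverse p ++ [ y ]) ℤ.≤ h w) (sym split) bound))
  where
  split : reverse (p ++ q) ++ [ y ] ≡ reverse q ++ (reverse p ++ [ y ])
  split = trans (cong (_++ [ y ]) (Listₚ.reverse-++ p q)) (Listₚ.++-assoc (reverse q) (reverse p) [ y ])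
  bound : h (reverse p ++ [ y ]) ℤ.≤ h (reverse q ++ (reverse p ++ [ y ]))
  -- The case split exhibits a first letter of `reverse p ++ [ y ]`, the letter at which `h-suffix`
  -- cuts.
  bound with reverse p | subst Ballot split bal
  ... | []    | b = h-suffix (reverse q) b
  ... | _ ∷ _ | b = h-suffix (reverse q) b

-- First α and ω are glued at x, then γ is glued on at y. At the end of αω the height is h(αx) + 1,
-- and along γ it falls by at most h(γ′y) = h(αx), so it stays at least 1. Finally αωγ has height 1,
-- so the ballot word δ can be appended.
balanced⇒ballot : ∀ ω {α γ δ} → h (toList ω) ≡ 1ℤ → Ballot (toList ω) →
  Unique (α ++ toList ω ++ γ ++ δ) → h (α ++ toList ω ++ γ) ≡ h (toList ω) →
  Balanced (List⁺.head ω) (List⁺.last ω) α γ δ → Ballot (α ++ toList ω ++ γ ++ δ)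
balanced⇒ballot ω@(x ∷ v) {α} {γ} {δ} hω balω uniq ht (balanced left right level rest)
  with last-split ω
... | ω₀ , ω≡ = subst Ballot (sym (++-assoc₃ α (toList ω) γ δ))
  (ballot-++ (subst Unique (++-assoc₃ α (toList ω) γ δ) uniq) (trans ht hω)
    (subst Ballot (sym αωγ≡) (ballot-glue (α ++ ω₀) (subst Ballot αω≡ αω) γ-above)) rest)
  where
  y = List⁺.last ω
  αω≡ : α ++ toList ω ≡ (α ++ ω₀) ++ [ y ]
  αω≡ = trans (cong (α ++_) ω≡) (sym (Listₚ.++-assoc α ω₀ [ y ]))
  αωγ≡ : α ++ toList ω ++ γ ≡ (α ++ ω₀) ++ y ∷ γ
  αωγ≡ = trans (sym (Listₚ.++-assoc α (toList ω) γ)) (trans (cong (_++ γ) αω≡) (Listₚ.++-assoc (α ++ ω₀) [ y ] γ))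
  αω : Ballot (α ++ toList ω)
  αω = ballot-glue α left λ p q eq →
    ℤₚ.+-mono-≤ (left (α ++ [ x ]) [] (Listₚ.++-identityʳ _)) (balω (x ∷ p) q (cong (x ∷_) eq))
  γ-above : ∀ p q → p ++ q ≡ γ → 0ℤ ℤ.≤ h ((α ++ ω₀) ++ [ y ]) ℤ.+ h (y ∷ p)
  γ-above p q eq = begin
    0ℤ                                                   ≤⟨ ℤ.+≤+ z≤n ⟩
    1ℤ                                                   ≡⟨ cancel (h (α ++ [ x ])) ⟩
    h (α ++ [ x ]) ℤ.+ 1ℤ ℤ.+ ℤ.- h (α ++ [ x ])         ≡⟨ cong₂ (λ a b → h (α ++ [ x ]) ℤ.+ a ℤ.+ ℤ.- b) (sym hω) level ⟩
    h (α ++ [ x ]) ℤ.+ h (x ∷ v) ℤ.+ ℤ.- h (reverse γ ++ [ y ])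
                                                         ≤⟨ ℤₚ.+-monoʳ-≤ (h (α ++ [ x ]) ℤ.+ h (x ∷ v)) (h-prefix-≥ y γ p q eq right) ⟩
    h (α ++ [ x ]) ℤ.+ h (x ∷ v) ℤ.+ h (y ∷ p)           ≡⟨ cong (ℤ._+ h (y ∷ p)) (trans (sym (h-++ α x v)) (cong h αω≡)) ⟩
    h ((α ++ ω₀) ++ [ y ]) ℤ.+ h (y ∷ p)                 ∎
    where
    open ℤₚ.≤-Reasoning
    cancel : ∀ a → 1ℤ ≡ a ℤ.+ 1ℤ ℤ.+ ℤ.- a
    cancel = solve-∀

-- If γ could be extended by c, the step into c, being ±1, would be offset by
-- h(c) ≥ 0, so h(c) = 1 while the suffix c must have nonpositive height.
ballot⇒maximal : ∀ ω {α γ δ α₁ γ₁ δ₁} → h (toList ω) ≡ 1ℤ → Unique (α ++ toList ω ++ γ ++ δ) →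
  h (α ++ toList ω ++ γ) ≡ h (toList ω) → Ballot δ →
  Admissible ω (α ++ toList ω ++ γ ++ δ) α₁ γ₁ δ₁ → length γ₁ ≤ length γ
ballot⇒maximal ω {α} {γ} {δ} {α₁} {γ₁} {δ₁} hω uniq ht rest (admissible eq ht₁ (_ , _ , bal₁))
  with same-rest {ω} α α₁ uniq eq
... | refl , ρ≡ with ++-compare γ γ₁ (sym ρ≡)
...   | inj₁ (c , refl , _)       = length-≤ γ₁ c
...   | inj₂ ([] , refl , _)      = ℕₚ.≤-reflexive (cong length (Listₚ.++-identityʳ γ))
...   | inj₂ (c@(_ ∷ _) , refl , δ≡) = ⊥-elim
  (impossible (h c) (rest c δ₁ (sym δ≡))
    (ballot⇒nonpos (List⁺.last ω) (γ ++ c) bal₁ (List⁺.last ω ∷ γ) c refl)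
    (h-join {α ++ toList ω ++ γ} (h≢0⇒≢[] {α ++ toList ω ++ γ} hM λ ()) (λ ()) uniq-Mc))
  where
  M = α ++ toList ω ++ γ
  hM : h M ≡ 1ℤ
  hM = trans ht hω
  hMc : h (M ++ c) ≡ 1ℤ
  hMc = trans (cong h (sym (++-assoc₃ α (toList ω) γ c))) (trans ht₁ hω)
  uniq-Mc : Unique (M ++ c)
  uniq-Mc = unique-prefix (M ++ c) {δ₁} (subst Unique
    (trans (++-assoc₃ α (toList ω) γ δ) (trans (cong (M ++_) δ≡) (sym (Listₚ.++-assoc M c δ₁)))) uniq)
  impossible : ∀ z → 0ℤ ℤ.≤ z → z ℤ.≤ 0ℤ →
    ¬ (h (M ++ c) ≡ h M ℤ.+ z ℤ.+ 1ℤ ⊎ h (M ++ c) ≡ h M ℤ.+ z ℤ.+ -1ℤ)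
  impossible z 0≤z z≤0 j with ℤₚ.≤-antisym z≤0 0≤z
  -- Now h(c) = 0, so the joint equation reads 1 = 2 or 1 = 0.
  ... | refl rewrite hM | hMc with j
  ...   | inj₁ ()
  ...   | inj₂ ()

-- Converse of `decomposition⇒balanced`. Being ballot is not assumed of the whole word: it is
-- recovered from the balance conditions, together with the height condition and maximality.
balanced⇒decomposition : ∀ {n} ω {α γ δ} → h (toList ω) ≡ 1ℤ → Ballot (toList ω) →
  IsPermutation n (α ++ toList ω ++ γ ++ δ) → Balanced (List⁺.head ω) (List⁺.last ω) α γ δ →
  InX n ω (α ++ toList ω ++ γ ++ δ) × IsDecomposition ω (α ++ toList ω ++ γ ++ δ) α γ δ
balanced⇒decomposition ω@(x ∷ v) {α} {γ} {δ} hω balω perm B with last-split ω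
... | ω₀ , ω≡ =
  ((perm , balanced⇒ballot ω {α} {γ} hω balω uniq ht B) , α , γ , δ , refl , ht) ,
  isDecomposition (admissible refl ht (ballot⇒ℬ α ω γ perm (Balanced.right B)))
    (λ _ _ _ → ballot⇒maximal ω {α} {γ} hω uniq ht (Balanced.rest B))
  where
  uniq : Unique (α ++ toList ω ++ γ ++ δ)
  uniq = permutation-unique perm
  ht : h (α ++ toList ω ++ γ) ≡ h (toList ω)
  ht = trans (h-triple α ω₀ γ ω≡) (proj₂ (height-iff _ _ _)
    (trans (sym (ℤₚ.neg-involutive _))
      (cong ℤ.-_ (trans (sym (h-reverse-∷ (List⁺.last ω) γ)) (sym (Balanced.level B))))))

-- The reflection map and its inverse

-- Stated for an arbitrary pair of words, so that the map and its inverse are two instances of one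
-- construction.
Reflects : ℕ → List⁺ ℕ → List⁺ ℕ → Set
Reflects n ω₁ ω₂ = ∀ {π α γ δ} → InX n ω₁ π → IsDecomposition ω₁ π α γ δ →
  let σ = reverse γ ++ toList ω₂ ++ reverse α ++ δ in
  InX n ω₂ σ × IsDecomposition ω₂ σ (reverse γ) (reverse α) δ

reflect-↭ : ∀ {ω₁ ω₂ : Word} α γ {δ} → ω₁ ↭ ω₂ →
  reverse γ ++ ω₂ ++ reverse α ++ δ ↭ α ++ ω₁ ++ γ ++ δ
reflect-↭ {ω₁} {ω₂} α γ {δ} ω₁↭ω₂ =
  ↭-trans (++⁺ (↭-reverse γ) (++⁺ (↭-sym ω₁↭ω₂) (++⁺ (↭-reverse α) ↭-refl)))
  (↭-trans (shifts γ ω₁)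
  (↭-trans (++⁺ (↭-refl {x = ω₁}) (shifts γ α))
  (shifts ω₁ α)))

-- Translating to balance conditions and back leaves only their transfer, `turn`. Distinctness is
-- handed to `turn` because it is what keeps the letters of α and γ apart from those of the middle
-- word.
balanced⇒reflects : ∀ {n} ω₁ ω₂ → h (toList ω₁) ≡ 1ℤ → h (toList ω₂) ≡ 1ℤ → Ballot (toList ω₂) →
  toList ω₁ ↭ toList ω₂ →
  (∀ {α γ δ} → Unique (α ++ toList ω₁ ++ γ ++ δ) →
    Balanced (List⁺.head ω₁) (List⁺.last ω₁) α γ δ →
    Balanced (List⁺.head ω₂) (List⁺.last ω₂) (reverse γ) (reverse α) δ) →
  Reflects n ω₁ ω₂
balanced⇒reflects ω₁ ω₂ h₁ h₂ bal₂ ω₁↭ω₂ turn {α = α} {γ} (bp@(perm , _) , _)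
  D@(isDecomposition (admissible refl _ _) _) =
  balanced⇒decomposition ω₂ h₂ bal₂ (↭-trans (reflect-↭ α γ ω₁↭ω₂) perm)
    (turn (permutation-unique perm) (decomposition⇒balanced ω₁ h₁ bp D))

module _ {n ω₁ ω₂} (r : Reflects n ω₁ ω₂) where

  reflect : Setoid.Carrier (X n ω₁) → Setoid.Carrier (X n ω₂)
  reflect (π , inX) with decomposition-exists ω₁ inX
  ... | α , γ , δ , D = reverse γ ++ toList ω₂ ++ reverse α ++ δ , proj₁ (r inX D)

  -- `reflect` uses the decomposition produced by `decomposition-exists`; uniqueness makes the
  -- formula valid for any other one.
  reflect-decomposition : ∀ π {α γ δ} → IsDecomposition ω₁ (proj₁ π) α γ δ →
    proj₁ (reflect π) ≡ reverse γ ++ toList ω₂ ++ reverse α ++ δ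
  reflect-decomposition (π , inX) D with decomposition-exists ω₁ inX
  ... | _ , _ , _ , D₀ with decomposition-unique ω₁ inX D₀ D
  ...   | refl , refl , refl = refl

  -- Two membership proofs for the same word may lead `decomposition-exists` along different routes,
  -- but the decomposition is unique.
  reflect-cong : ∀ {π₁ π₂} → proj₁ π₁ ≡ proj₁ π₂ → proj₁ (reflect π₁) ≡ proj₁ (reflect π₂)
  reflect-cong {π₁} {π₂ , inX} refl with decomposition-exists ω₁ inX
  ... | _ , _ , _ , D = reflect-decomposition π₁ D

  reflect-isDecomposition : ∀ π {α γ δ} → IsDecomposition ω₁ (proj₁ π) α γ δ →
    IsDecomposition ω₂ (proj₁ (reflect π)) (reverse γ) (reverse α) δ
  reflect-isDecomposition π@(_ , inX) D =
    subst (λ σ → IsDecomposition ω₂ σ _ _ _) (sym (reflect-decomposition π D)) (proj₂ (r inX D))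

-- The decomposition of the image is known to be the exchanged one, so the second reflection
-- exchanges the parts again and the double reversals cancel.
reflect-involutive : ∀ {n ω₁ ω₂} (r : Reflects n ω₁ ω₂) (s : Reflects n ω₂ ω₁) π →
  proj₁ (reflect s (reflect r π)) ≡ proj₁ π
reflect-involutive {ω₁ = ω₁} r s π =
  let _ , _ , _ , D = decomposition-exists ω₁ (proj₂ π) in reflect-back D
  where
  open ≡-Reasoning
  reflect-back : ∀ {α γ δ} → IsDecomposition ω₁ (proj₁ π) α γ δ → proj₁ (reflect s (reflect r π)) ≡ proj₁ π
  reflect-back {α} {γ} {δ} D = begin
    proj₁ (reflect s (reflect r π))
      ≡⟨ reflect-decomposition s (reflect r π) (reflect-isDecomposition r π D) ⟩
    reverse (reverse α) ++ toList ω₁ ++ reverse (reverse γ) ++ δ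
      ≡⟨ cong₂ (λ a c → a ++ toList ω₁ ++ c ++ δ) (Listₚ.reverse-involutive α) (Listₚ.reverse-involutive γ) ⟩
    α ++ toList ω₁ ++ γ ++ δ
      ≡⟨ Admissible.splits (IsDecomposition.isAdmissible D) ⟨
    proj₁ π ∎

reflection : ∀ {n ω₁ ω₂} → Reflects n ω₁ ω₂ → Reflects n ω₂ ω₁ → Inverse (X n ω₁) (X n ω₂)
reflection r s = record
  { to        = reflect r
  ; from      = reflect s
  ; to-cong   = λ {π₁} {π₂} → reflect-cong r {π₁} {π₂}
  ; from-cong = λ {σ₁} {σ₂} → reflect-cong s {σ₁} {σ₂}
  ; inverse   =
      (λ {σ} {π} eq → trans (reflect-cong r {π} {reflect s σ} eq) (reflect-involutive s r σ)) ,
      (λ {π} {σ} eq → trans (reflect-cong s {σ} {reflect r π} eq) (reflect-involutive r s π))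
  }

-- Replacing the last letter of a word

-- Only the final adjacent pair sees the replaced letter. The hypothesis is asked of all letters of
-- `w` so that it passes to the reversal of a word.
h-relast : ∀ {a b} w → All (λ g → h (g ∷ a ∷ []) ≡ h (g ∷ b ∷ [])) w → h (w ++ [ a ]) ≡ h (w ++ [ b ])
h-relast []          _        = refl
h-relast (_ ∷ [])    (eq ∷ _) = eq
h-relast {a} {b} (g ∷ g′ ∷ w) (_ ∷ eqs) =
  trans (h-++ [ g ] g′ (w ++ [ a ]))
    (trans (cong (ℤ._+_ (h (g ∷ g′ ∷ []))) (h-relast (g′ ∷ w) eqs)) (sym (h-++ [ g ] g′ (w ++ [ b ]))))

ballot-relast : ∀ {a b} w → h (w ++ [ a ]) ≡ h (w ++ [ b ]) → Ballot (w ++ [ a ]) → Ballot (w ++ [ b ])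
ballot-relast {a} {b} w eq bal u v uv≡ with ++-compare w u uv≡
... | inj₁ (c , w≡ , _)        = ballot-prefix w bal u c (sym w≡)
... | inj₂ ([] , refl , _)     = ballot-prefix w bal (w ++ []) [] (trans (Listₚ.++-identityʳ _) (Listₚ.++-identityʳ w))
... | inj₂ (_ ∷ [] , refl , refl) = subst (0ℤ ℤ.≤_) eq (bal (w ++ [ a ]) [] (Listₚ.++-identityʳ _))
... | inj₂ (_ ∷ _ ∷ _ , _ , ())

-- No integer lies strictly between `k` and `suc k`, so both compare alike with any other `g`.
h-successor : ∀ {g k} → g ≢ k → g ≢ suc k → h (g ∷ k ∷ []) ≡ h (g ∷ suc k ∷ [])
h-successor {g} {k} g≢k g≢1+k with ℕₚ.<-cmp g k
... | tri< g<k _ _ = trans (ascent g<k) (sym (ascent (ℕₚ.m<n⇒m<1+n g<k)))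
... | tri≈ _ g≡k _ = ⊥-elim (g≢k g≡k)
... | tri> _ _ k<g = trans (descent k<g) (sym (descent (ℕₚ.≤∧≢⇒< k<g (≢-sym g≢1+k))))

-- The words λ and μ, with `k` standing for j - 1

module _ {n i k : ℕ} (i<k : i < k) (1+k<n : suc k < n) where

  private
    lam mu : List⁺ ℕ
    lam = i ∷ n ∷ k ∷ suc k ∷ []
    mu  = k ∷ suc k ∷ n ∷ i ∷ []

    k<n : k < n
    k<n = ℕₚ.<-trans (ℕₚ.n<1+n k) 1+k<n
    i<n : i < n
    i<n = ℕₚ.<-trans i<k k<n

  h-ink : h (i ∷ n ∷ k ∷ []) ≡ 0ℤ
  h-ink = trans (h-++ [ i ] n [ k ]) (cong₂ ℤ._+_ (ascent i<n) (descent k<n))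

  h-lam : h (toList lam) ≡ 1ℤ
  h-lam = trans (h-++ (i ∷ n ∷ []) k [ suc k ]) (cong₂ ℤ._+_ h-ink (ascent (ℕₚ.n<1+n k)))

  h-kjn : h (k ∷ suc k ∷ n ∷ []) ≡ ℤ.+ 2
  h-kjn = trans (h-++ [ k ] (suc k) [ n ]) (cong₂ ℤ._+_ (ascent (ℕₚ.n<1+n k)) (ascent 1+k<n))

  h-mu : h (toList mu) ≡ 1ℤ
  h-mu = trans (h-++ (k ∷ suc k ∷ []) n [ i ]) (cong₂ ℤ._+_ h-kjn (descent i<n))

  ballot-lam : Ballot (toList lam)
  ballot-lam []                      _ refl = ℤ.+≤+ z≤n
  ballot-lam (_ ∷ [])                _ refl = ℤ.+≤+ z≤n
  ballot-lam (_ ∷ _ ∷ [])            _ refl = subst (0ℤ ℤ.≤_) (sym (ascent i<n)) (ℤ.+≤+ z≤n)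
  ballot-lam (_ ∷ _ ∷ _ ∷ [])        _ refl = subst (0ℤ ℤ.≤_) (sym h-ink) (ℤ.+≤+ z≤n)
  ballot-lam (_ ∷ _ ∷ _ ∷ _ ∷ [])    _ refl = subst (0ℤ ℤ.≤_) (sym h-lam) (ℤ.+≤+ z≤n)
  ballot-lam (_ ∷ _ ∷ _ ∷ _ ∷ _ ∷ _) _ ()

  ballot-mu : Ballot (toList mu)
  ballot-mu []                      _ refl = ℤ.+≤+ z≤n
  ballot-mu (_ ∷ [])                _ refl = ℤ.+≤+ z≤n
  ballot-mu (_ ∷ _ ∷ [])            _ refl = subst (0ℤ ℤ.≤_) (sym (ascent (ℕₚ.n<1+n k))) (ℤ.+≤+ z≤n)
  ballot-mu (_ ∷ _ ∷ _ ∷ [])        _ refl = subst (0ℤ ℤ.≤_) (sym h-kjn) (ℤ.+≤+ z≤n)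
  ballot-mu (_ ∷ _ ∷ _ ∷ _ ∷ [])    _ refl = subst (0ℤ ℤ.≤_) (sym h-mu) (ℤ.+≤+ z≤n)
  ballot-mu (_ ∷ _ ∷ _ ∷ _ ∷ _ ∷ _) _ ()

  -- Reversing λ gives j (j-1) n i, which differs from μ only in the order of its first two letters.
  lam↭mu : toList lam ↭ toList mu
  lam↭mu = ↭-trans (↭-sym (↭-reverse (toList lam))) (swap (suc k) k ↭-refl)

  -- The condition on γ′ is given with final letter `suc k` and wanted with final letter `k`. The
  -- letters of γ differ from both, so the replacement preserves heights and the ballot property;
  -- the condition at `i` is carried over unchanged.
  turn-lam : ∀ {α γ δ} → Unique (α ++ toList lam ++ γ ++ δ) →
    Balanced i (suc k) α γ δ → Balanced k i (reverse γ) (reverse α) δ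
  turn-lam {α} {γ} {δ} uniq (balanced left right level rest) =
    balanced-reverse α (ballot-relast (reverse γ) (sym relast) right) left
      (trans relast (sym level)) rest
    where
    avoid : All (λ g → h (g ∷ k ∷ []) ≡ h (g ∷ suc k ∷ [])) γ
    avoid with unique-suffix α uniq
    ... | _ ∷ _ ∷ (_ ∷ k∉) ∷ j∉ ∷ _ =
      All.zipWith (λ (p , q) → h-successor (≢-sym p) (≢-sym q)) (Allₚ.++⁻ˡ γ k∉ , Allₚ.++⁻ˡ γ j∉)
    relast : h (reverse γ ++ [ k ]) ≡ h (reverse γ ++ [ suc k ])
    relast = h-relast (reverse γ) (All-resp-↭ (↭-sym (↭-reverse γ)) avoid)

  turn-mu : ∀ {α γ δ} → Unique (α ++ toList mu ++ γ ++ δ) →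
    Balanced k i α γ δ → Balanced i (suc k) (reverse γ) (reverse α) δ
  turn-mu {α} {γ} {δ} uniq (balanced left right level rest) =
    balanced-reverse α right (ballot-relast α relast left) (trans (sym level) relast) rest
    where
    avoid : All (λ g → h (g ∷ k ∷ []) ≡ h (g ∷ suc k ∷ [])) α
    -- Here α stands before μ; moving μ to the front makes the distinctness facts for `k` and
    -- `suc k` range over α.
    avoid with unique-resp-↭ (shifts α (toList mu)) uniq
    ... | (_ ∷ _ ∷ _ ∷ k∉) ∷ (_ ∷ _ ∷ j∉) ∷ _ =
      All.zipWith (λ (p , q) → h-successor (≢-sym p) (≢-sym q)) (Allₚ.++⁻ˡ α k∉ , Allₚ.++⁻ˡ α j∉)
    relast : h (α ++ [ k ]) ≡ h (α ++ [ suc k ])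
    relast = h-relast α avoid

  lam-reflects-mu : Reflects n lam mu
  lam-reflects-mu = balanced⇒reflects lam mu h-lam h-mu ballot-mu lam↭mu
    λ {α} {γ} {δ} → turn-lam {α} {γ} {δ}

  mu-reflects-lam : Reflects n mu lam
  mu-reflects-lam = balanced⇒reflects mu lam h-mu h-lam ballot-lam (↭-sym lam↭mu)
    λ {α} {γ} {δ} → turn-mu {α} {γ} {δ}

theorem2p3 : ∀ (n i j : ℕ) → 1 ≤ n → 1 ≤ i → 1 ≤ j → i + 2 ≤ j → j ≤ n ∸ 1 →
  let lam : List⁺ ℕ
      lam = i ∷ n ∷ (j ∸ 1) ∷ j ∷ []
      mu : List⁺ ℕ
      mu = (j ∸ 1) ∷ j ∷ n ∷ i ∷ []
  in
  (∀ (π α γ δ : Word) → InX n lam π → IsDecomposition lam π α γ δ →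
     InX n mu (reverse γ ++ toList mu ++ reverse α ++ δ) ×
     IsDecomposition mu (reverse γ ++ toList mu ++ reverse α ++ δ) (reverse γ) (reverse α) δ) ×
  (Σ[ Φ ∈ Inverse (X n lam) (X n mu) ]
     (∀ (π : Setoid.Carrier (X n lam)) (α γ δ : Word) → IsDecomposition lam (proj₁ π) α γ δ →
        proj₁ (Inverse.to Φ π) ≡ reverse γ ++ toList mu ++ reverse α ++ δ) ×
     (∀ (σ : Setoid.Carrier (X n mu)) (α γ δ : Word) → IsDecomposition mu (proj₁ σ) α γ δ →
        proj₁ (Inverse.from Φ σ) ≡ reverse γ ++ toList lam ++ reverse α ++ δ ×
        IsDecomposition lam (proj₁ (Inverse.from Φ σ)) (reverse γ) (reverse α) δ))
-- Matching `n` and `j` as successors makes the truncated subtractions compute: `n ∸ 1` is `m` and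
-- `j ∸ 1` is `k`. The bound `j ≤ m` then yields `suc k < n`.
theorem2p3 n@(suc m) i j@(suc k) 1≤n 1≤i 1≤j i+2≤j j≤m =
  (λ _ _ _ _ → r) ,
  reflection r s ,
  (λ π _ _ _ → reflect-decomposition r π) ,
  (λ σ _ _ _ D → reflect-decomposition s σ D , reflect-isDecomposition s σ D)
  where
  i<k : i < k
  i<k = ℕₚ.≤-pred (subst (_≤ suc k) (ℕₚ.+-comm i 2) i+2≤j)
  r : Reflects n (i ∷ n ∷ k ∷ j ∷ []) (k ∷ j ∷ n ∷ i ∷ [])
  r = lam-reflects-mu i<k (s≤s j≤m)
  s : Reflects n (k ∷ j ∷ n ∷ i ∷ []) (i ∷ n ∷ k ∷ j ∷ [])
  s = mu-reflects-lam i<k (s≤s j≤m)
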